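{- For every context $\Gamma$ and formula $A$: if the sequent $\Gamma\vdash A$ is derivable in the sequent calculus, then it has a focused derivation.
   Context: Formulas are built from atoms ($p,q,\dots$) by a binary product: every formula is an atom or $A\bullet B$. A context is a finite (possibly empty) list of formulas; commas denote concatenation. The sequent calculus has exactly four rules (no weakening, contraction or exchange): ($\bullet L$) from $A,B,\Delta\vdash C$ infer $A\bullet B,\Delta\vdash C$ (the product must be the leftmost formula); ($\bullet R$) from $\Gamma\vdash A$ and $\Delta\vdash B$ infer $\Gamma,\Delta\vdash A\bullet B$; ($id$) $A\vdash A$; ($cut$) from $\Theta\vdash A$ and $\Gamma,A,\Delta\vdash B$ infer $\Gamma,\Theta,\Delta\vdash B$. A sequent is derivable if it is the conclusion of a finite derivation tree of these rules with no undischarged premises. A context is irreducible if its leftmost formula is not a product (i.e. it is empty or begins with an atom), and reducible otherwise. A focused derivation is a finite derivation tree (with no undischarged premises) using only: the rule ($\bullet L$); the restricted rule ($\bullet R^{foc}$): from $\Gamma\vdash A$ and $\Delta\vdash B$ infer $\Gamma,\Delta\vdash A\bullet B$, where $\Gamma$ is irreducible; and the restricted rule ($id^{atm}$): $p\vdash p$ for atoms $p$ (no cut). -}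

module Defs where

open import Data.List.Base using (List; []; _∷_; _++_; [_])
open import Level using (Level)

infixr 8 _•_
infix  4 _⊢_ _⊢ᶠ_

data Formula {a : Level} (Atom : Set a) : Set a where
  atom : Atom → Formula Atom
  _•_  : Formula Atom → Formula Atom → Formula Atom

Context : {a : Level} → Set a → Set a
Context Atom = List (Formula Atom)

data Irreducible {a : Level} {Atom : Set a} : Context Atom → Set a where
  empty  : Irreducible []
  atom∷  : {p : Atom} {Γ : Context Atom} → Irreducible (atom p ∷ Γ)

data _⊢_ {a : Level} {Atom : Set a} : Context Atom → Formula Atom → Set a where
  •L  : {A B C : Formula Atom} {Δ : Context Atom} →
        A ∷ B ∷ Δ ⊢ C → A • B ∷ Δ ⊢ C
  •R  : {A B : Formula Atom} {Γ Δ : Context Atom} →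
        Γ ⊢ A → Δ ⊢ B → Γ ++ Δ ⊢ A • B
  id  : {A : Formula Atom} → [ A ] ⊢ A
  cut : {A B : Formula Atom} {Θ : Context Atom} (Γ : Context Atom) {Δ : Context Atom} →
        Θ ⊢ A → Γ ++ A ∷ Δ ⊢ B → Γ ++ Θ ++ Δ ⊢ B

data _⊢ᶠ_ {a : Level} {Atom : Set a} : Context Atom → Formula Atom → Set a where
  •L  : {A B C : Formula Atom} {Δ : Context Atom} →
        A ∷ B ∷ Δ ⊢ᶠ C → A • B ∷ Δ ⊢ᶠ C
  •Rᶠ : {A B : Formula Atom} {Γ Δ : Context Atom} →
        Irreducible Γ → Γ ⊢ᶠ A → Δ ⊢ᶠ B → Γ ++ Δ ⊢ᶠ A • B
  idᵃ : {p : Atom} → [ atom p ] ⊢ᶠ atom p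

{-# OPTIONS --safe #-}
-- The unrestricted product rule, the identity and the cut are admissible for focused derivations.
-- For the product rule, the left premise is either irreducible or ends in •L, which commutes
-- below. A cut is pushed up its right premise until it meets idᵃ, where it is trivial, or the
-- cut formula is decomposed by •L at the head of the context; in the latter case it is pushed up
-- its left premise until the formula is introduced by •Rᶠ, and then replaced by cuts on the two
-- factors.
module Submission where

open import Defs
open import Data.List.Base using (List; []; _∷_; _++_; [_])
open import Data.List.Properties using (++-assoc; ++-identityʳ; ∷-injective)
open import Data.Product.Base using (∃-syntax; _×_; _,_)
open import Data.Sum.Base using (_⊎_; inj₁; inj₂)
open import Level using (Level)
open import Relation.Binary.PropositionalEquality using (_≡_; refl; sym; trans; cong; subst)
open import Relation.Nullary.Negation using (¬_; contradiction)

private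
  variable
    a : Level
    Atom : Set a
    A B C : Formula Atom
    Γ Δ Θ Ω : Context Atom

-- Tells which premise of `•Rᶠ` receives the cut formula `w`.
++-≡-++∷ : ∀ {X : Set a} (xs : List X) {ys : List X} (zs : List X) {w : X} {ws : List X} →
           xs ++ ys ≡ zs ++ w ∷ ws →
           (∃[ us ] xs ≡ zs ++ w ∷ us × ws ≡ us ++ ys) ⊎
           (∃[ us ] zs ≡ xs ++ us × ys ≡ us ++ w ∷ ws)
++-≡-++∷ []       zs       eq   = inj₂ (zs , refl , eq)
++-≡-++∷ (x ∷ xs) []       refl = inj₁ (xs , refl , refl)
++-≡-++∷ (x ∷ xs) (z ∷ zs) eq with ∷-injective eq
... | refl , eq′ with ++-≡-++∷ xs zs eq′
...   | inj₁ (us , refl , q) = inj₁ (us , refl , q)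
...   | inj₂ (us , refl , q) = inj₂ (us , refl , q)

[]⊬ᶠ : ¬ ([] ⊢ᶠ A)
[]⊬ᶠ d = nonempty d refl
  where
  nonempty : Γ ⊢ᶠ A → ¬ (Γ ≡ [])
  nonempty (•Rᶠ empty d _) _ = nonempty d refl

-- An empty `Γ` would expose the head of `Δ`; the derivation rules it out.
irreducible-++ : Irreducible Γ → Γ ⊢ᶠ A → Irreducible (Γ ++ Δ)
irreducible-++ empty d = contradiction d []⊬ᶠ
irreducible-++ atom∷ _ = atom∷

•Rᶠ-unrestricted : Γ ⊢ᶠ A → Δ ⊢ᶠ B → Γ ++ Δ ⊢ᶠ A • B
•Rᶠ-unrestricted (•L d)          e = •L (•Rᶠ-unrestricted d e)
•Rᶠ-unrestricted d@(•Rᶠ irr l _) e = •Rᶠ (irreducible-++ irr l) d e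
•Rᶠ-unrestricted idᵃ             e = •Rᶠ atom∷ idᵃ e

idᶠ : (A : Formula Atom) → [ A ] ⊢ᶠ A
idᶠ (atom p) = idᵃ
idᶠ (A • B)  = •L (•Rᶠ-unrestricted (idᶠ A) (idᶠ B))

-- The context of the right premise is given up to ≡ so that its derivation can be matched on.
cutᶠ : (A : Formula Atom) (Γ : Context Atom) → Θ ⊢ᶠ A → Ω ⊢ᶠ C → Ω ≡ Γ ++ A ∷ Δ →
       Γ ++ Θ ++ Δ ⊢ᶠ C
cutᶠ A (_ ∷ Γ) d (•L e) refl = •L (cutᶠ A (_ ∷ _ ∷ Γ) d e refl)
cutᶠ (A • B) [] (•L d) e@(•L _) refl = •L (cutᶠ (A • B) [] d e refl)
cutᶠ {Δ = Δ} (A • B) [] (•Rᶠ {Γ = Γ₁} {Δ = Γ₂} _ d₁ d₂) (•L e) refl =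
  -- Both cuts are on smaller formulas, so the size of the derivation returned by the inner one does
  -- not matter.
  subst (_⊢ᶠ _) (sym (++-assoc Γ₁ Γ₂ Δ))
    (cutᶠ A [] d₁ (cutᶠ B [ A ] d₂ e refl) refl)
cutᶠ {Θ = Θ} {Δ = Δ} A Γ d (•Rᶠ {Γ = Γ₁} {Δ = Γ₂} _ e₁ e₂) eq with ++-≡-++∷ Γ₁ Γ eq
... | inj₁ (Δ₁ , refl , refl) =
  subst (_⊢ᶠ _)
    (trans (++-assoc Γ (Θ ++ Δ₁) Γ₂) (cong (Γ ++_) (++-assoc Θ Δ₁ Γ₂)))
    -- When `Γ` is empty, `Θ` comes to the head, and it may be reducible.
    (•Rᶠ-unrestricted (cutᶠ A Γ d e₁ refl) e₂)
... | inj₂ (Γ₃ , refl , refl) =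
  subst (_⊢ᶠ _) (sym (++-assoc Γ₁ Γ₃ (Θ ++ Δ)))
    (•Rᶠ-unrestricted e₁ (cutᶠ A Γ₃ d e₂ refl))
cutᶠ {Θ = Θ} A [] d idᵃ refl = subst (_⊢ᶠ _) (sym (++-identityʳ Θ)) d
cutᶠ A (_ ∷ []) d idᵃ ()
cutᶠ A (_ ∷ _ ∷ _) d idᵃ ()

theorem1p12 : {a : Level} {Atom : Set a} →
    (Γ : Context Atom) (A : Formula Atom) → Γ ⊢ A → Γ ⊢ᶠ A
theorem1p12 _ _ (•L d)      = •L (theorem1p12 _ _ d)
theorem1p12 _ _ (•R d e)    = •Rᶠ-unrestricted (theorem1p12 _ _ d) (theorem1p12 _ _ e)
theorem1p12 _ _ id          = idᶠ _
theorem1p12 _ _ (cut Γ d e) = cutᶠ _ Γ (theorem1p12 _ _ d) (theorem1p12 _ _ e) refl
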